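{- Let $(k,\alpha)\in\Upsilon$. If $u\in\operatorname{rext}(L_{k,\alpha})$ and $v\in\operatorname{lext}(L_{k,\alpha})$, then there exists a word $w\in L_{k,\alpha}$ such that $uwv\in L_{k,\alpha}$.
   Context: $\Sigma_k$ is an alphabet with $k$ letters. For a nonempty finite word $r$ and a rational $\beta\ge 1$ with $\beta|r|$ an integer, the $\beta$-power $r^\beta$ is the word $rr\cdots rt$ of length $\beta|r|$, where $t$ is a prefix of $r$ (e.g. $(1234)^{7/4}=1234123$). For rational $\alpha\ge1$, a finite or infinite word is $\alpha$-power free if it has no factor that is a $\beta$-power (of some nonempty word) with $\beta\ge\alpha$, and $\alpha^+$-power free if it has no factor that is a $\beta$-power with $\beta>\alpha$. Below "$\alpha$" may denote either a rational number or a symbol $\alpha^+$ ("number with $+$"), and "$\alpha$-power free" is interpreted accordingly. $L_{k,\alpha}\subseteq\Sigma_k^*$ is the set of finite $\alpha$-power free words over $\Sigma_k$. $\Upsilon$ is the set of pairs consisting of: $(k,\alpha)$ with $k=3$ and rational $\alpha>2$; $(k,\alpha)$ with $k>3$ and rational $\alpha\ge2$; and $(k,\alpha^+)$ with $k\ge3$ and rational $\alpha\ge2$. For a language $L\subseteq\Sigma_k^*$, a word $w\in L$ is left (resp. right) extendable in $L$ if for every $n\in\mathbb N$ there is $u\in L$ with $|u|=n$ and $uw\in L$ (resp. $wu\in L$). $\operatorname{lext}(L)$ (resp. $\operatorname{rext}(L)$) is the set of left (resp. right) extendable words of $L$. -}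

module Defs where

open import Data.Fin.Base using (Fin)
open import Data.Integer.Base using (+_)
open import Data.List.Base using (List; []; _++_; concat; length; replicate)
open import Data.List.Relation.Binary.Infix.Heterogeneous using (Infix)
open import Data.List.Relation.Binary.Prefix.Heterogeneous using (Prefix)
open import Data.Nat.Base as ℕ using (ℕ)
open import Data.Product.Base using (∃-syntax; _×_)
open import Data.Rational.Base using (ℚ; _/_; _*_; _≤_; _<_; 1ℚ)
open import Level using (0ℓ)
open import Relation.Binary.PropositionalEquality.Core using (_≡_; _≢_)
open import Relation.Nullary.Negation.Core using (¬_)
open import Relation.Unary using (Pred; _∈_)

Word : ℕ → Set
Word k = List (Fin k)

Language : ℕ → Set₁
Language k = Pred (Word k) 0ℓ

fromℕ : ℕ → ℚ
fromℕ n = + n / 1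

-- IsPower β r x : x is the word r^β.  The last equation also says that
-- β|r| is an integer.
IsPower : ∀ {k} → ℚ → Word k → Word k → Set
IsPower β r x =
  r ≢ [] × 1ℚ ≤ β ×
  ∃[ m ] ∃[ t ] Prefix _≡_ t r ×
                x ≡ concat (replicate m r) ++ t ×
                fromℕ (length x) ≡ β * fromℕ (length r)

-- A rational number α, or the symbol α⁺.
data Exponent : Set where
  num  : ℚ → Exponent
  _⁺   : ℚ → Exponent

-- Forbidden α β : β-powers may not occur in an α-power free word.
Forbidden : Exponent → ℚ → Set
Forbidden (num α) β = α ≤ β
Forbidden (α ⁺)   β = α < β

PowerFree : ∀ {k} → Exponent → Word k → Set
PowerFree {k} α w =
  ¬ (∃[ x ] ∃[ r ] ∃[ β ] Infix _≡_ x w × IsPower {k} β r x × Forbidden α β)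

L : (k : ℕ) → Exponent → Language k
L k α w = PowerFree α w

data Υ : ℕ → Exponent → Set where
  ternary : ∀ {α} → fromℕ 2 < α → Υ 3 (num α)
  larger  : ∀ {k α} → 3 ℕ.< k → fromℕ 2 ≤ α → Υ k (num α)
  plus    : ∀ {k α} → 3 ℕ.≤ k → fromℕ 2 ≤ α → Υ k (α ⁺)

lext : ∀ {k} → Language k → Language k
lext 𝓛 w = w ∈ 𝓛 × (∀ n → ∃[ u ] u ∈ 𝓛 × length u ≡ n × u ++ w ∈ 𝓛)

rext : ∀ {k} → Language k → Language k
rext 𝓛 w = w ∈ 𝓛 × (∀ n → ∃[ u ] u ∈ 𝓛 × length u ≡ n × w ++ u ∈ 𝓛)

{-# OPTIONS --safe #-}
-- Let s be a long word of L with prefix u, let x be a letter at a far position P of s, and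
-- let T be a long word without x that is overlap-free or, over three letters, square-free.
-- If s[0..p] ends in x but s[0..p]·T is not power free, the offending power straddles the
-- border; its period is longer than its part l′ inside T (T has no x), so one period earlier
-- s contains x followed by l′ letters of T.  This is a longer match with T at a position
-- q ≥ (p − l′ − 1) / 2.  Iterating, the match grows while the position at most
-- halves, so a sufficiently far start ends at a power-free s[0..p]·T before reaching u; for
-- this T is shifted so that no long prefix of it occurs after an x in u, which one of |u| + 1
-- shifts achieves because two shifts with equal long prefixes would make T overlap itself.
-- Treating v symmetrically with the same letter x and a common long T gives the transition.
-- If the letters on the two sides differ, first graft onto u a T that avoids the left letter
-- and has the right letter at a far position.
module Submission where

open import Defs
open import Data.Bool.Base using (Bool; true; false; not; _xor_)
open import Data.Bool.Properties using (not-injective; not-¬; not-involutive) renaming (_≟_ to _≟ᵇ_)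
open import Data.Empty using (⊥)
open import Data.Fin.Base using (Fin; zero; suc; toℕ; fromℕ<; punchIn; punchOut; inject≤)
open import Data.Fin.Permutation.Components using (transpose; transpose-inverse)
open import Data.Fin.Properties
  using (toℕ<n; toℕ-fromℕ<; any?; pigeonhole; punchIn-injective; punchInᵢ≢i;
         punchIn-punchOut; inject≤-injective)
  renaming (_≟_ to _≟ᶠ_)
import Data.Integer.Base as ℤ
import Data.Integer.Properties as ℤ
open import Data.List.Base using (List; []; _∷_; _++_; concat; length; replicate; applyUpTo)
open import Data.List.Properties using (++-assoc; length-++; length-applyUpTo)
open import Data.List.Relation.Binary.Infix.Heterogeneous as Infix using (MkView)
open import Data.List.Relation.Binary.Pointwise using (Pointwise-≡⇒≡; ≡⇒Pointwise-≡)
open import Data.List.Relation.Binary.Prefix.Heterogeneous using (Prefix; []; _∷_; _++ᵖ_)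
open import Data.Nat.Base hiding (_/_)
open import Data.Nat.Properties
open import Data.Nat.Tactic.RingSolver using (solve-∀)
open import Data.Product.Base using (∃; ∃-syntax; _×_; _,_; proj₁; proj₂)
open import Data.Rational.Base as ℚ using (1ℚ)
import Data.Rational.Properties as ℚ
open import Data.Rational.Unnormalised.Base as ℚᵘ using (mkℚᵘ)
import Data.Rational.Unnormalised.Properties as ℚᵘ
open import Data.Sum.Base using (_⊎_; inj₁; inj₂)
open import Function.Base using (_∘_)
open import Relation.Binary.Definitions using (DecidableEquality)
open import Relation.Binary.PropositionalEquality
open import Relation.Nullary using (¬_; Dec; yes; no; contradiction; _×-dec_)
open import Relation.Nullary.Decidable using (decidable-stable)
open import Relation.Unary using (_∈_)

-- Words as functions: periods, mirror images, splicing

private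
  variable
    A C : Set

-- Finite words are represented by functions ℕ → A of which only an initial segment matters.
Period : (ℕ → A) → ℕ → ℕ → ℕ → Set
Period c a ℓ d = ∀ j → j + d < ℓ → c (a + j) ≡ c (a + (j + d))

-- `B ℓ d` selects the forbidden combinations of length and period, so the combinatorics never
-- touches rational exponents. `Square` corresponds to exponent at least 2, `Overlap` to exponent
-- above 2, and `Bad α` below to the exponents forbidden by `α`.
Avoids : (ℕ → ℕ → Set) → (ℕ → A) → ℕ → Set
Avoids B c n = ∀ a ℓ d → a + ℓ ≤ n → B ℓ d → ¬ Period c a ℓ d

Square Overlap : ℕ → ℕ → Set
Square  ℓ d = 0 < d × d + d ≤ ℓ
Overlap ℓ d = 0 < d × d + d < ℓ

period-transfer : ∀ (c : ℕ → A) a (c′ : ℕ → A) a′ {ℓ d} → (∀ i → i < ℓ → c (a + i) ≡ c′ (a′ + i)) →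
                  Period c a ℓ d → Period c′ a′ ℓ d
period-transfer c a c′ a′ {d = d} eq per j lt =
  trans (sym (eq j (≤-trans (s≤s (m≤m+n j d)) lt))) (trans (per j lt) (eq (j + d) lt))

module _ {B : ℕ → ℕ → Set} where

  avoids-⊆ : ∀ {B′ : ℕ → ℕ → Set} (c : ℕ → A) {n} →
             (∀ {ℓ d} → B ℓ d → B′ ℓ d) → Avoids B′ c n → Avoids B c n
  avoids-⊆ c B⊆B′ av a ℓ d le b = av a ℓ d le (B⊆B′ b)

  avoids-shorten : ∀ (c : ℕ → A) {m n} → m ≤ n → Avoids B c n → Avoids B c m
  avoids-shorten c m≤n av a ℓ d le = av a ℓ d (≤-trans le m≤n)

  avoids-drop : ∀ (c : ℕ → A) m {n} → Avoids B c (m + n) → Avoids B (λ i → c (m + i)) n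
  avoids-drop c m av a ℓ d le b =
    av (m + a) ℓ d (≤-trans (≤-reflexive (+-assoc m a ℓ)) (+-monoʳ-≤ m le)) b
      ∘ period-transfer (λ i → c (m + i)) a c (m + a) λ i _ → cong c (sym (+-assoc m a i))

  avoids-map : ∀ (c : ℕ → A) {n} (f : A → C) → (∀ {x y} → f x ≡ f y → x ≡ y) →
               Avoids B c n → Avoids B (f ∘ c) n
  avoids-map c f inj av a ℓ d le b per = av a ℓ d le b λ j lt → inj (per j lt)

  avoids-cong : ∀ (c c′ : ℕ → A) {n} → (∀ i → i < n → c i ≡ c′ i) →
                Avoids B c n → Avoids B c′ n
  avoids-cong c c′ eq av a ℓ d le b =
    av a ℓ d le b ∘ period-transfer c′ a c a λ i lt → sym (eq _ (≤-trans (+-monoʳ-< a lt) le))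

-- Only the first `n` letters are mirrored; truncated subtraction makes every later position read
-- `c 0`.
rev : ℕ → (ℕ → A) → ℕ → A
rev n c m = c (n ∸ suc m)

∸-suc-+ : ∀ {n} m k → n ≡ suc m + k → n ∸ suc m ≡ k
∸-suc-+ m k refl = m+n∸m≡n (suc m) k

rev-+ : ∀ (c : ℕ → A) {n} m k → n ≡ suc m + k → rev n c m ≡ c k
rev-+ c m k eq = cong c (∸-suc-+ m k eq)

avoids-rev : ∀ {B : ℕ → ℕ → Set} (c : ℕ → A) {n} → Avoids B c n → Avoids B (rev n c) n
avoids-rev c av a ℓ d le b per
  with k , refl ← m≤n⇒∃[o]m+o≡n le =
  av k ℓ d (≤-trans (m≤m+n (k + ℓ) a) (≤-reflexive (lem₀ a ℓ k))) b mirrored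
  where
  lem₀ : ∀ a ℓ k → k + ℓ + a ≡ a + ℓ + k
  lem₀ = solve-∀
  lem₁ : ∀ a j d i k → a + (suc (j + d) + i) + k ≡ suc (a + (i + d)) + (k + j)
  lem₁ = solve-∀
  lem₂ : ∀ i d j → suc (i + d) + j ≡ suc (j + d) + i
  lem₂ = solve-∀
  lem₃ : ∀ a j d i k → a + (suc (j + d) + i) + k ≡ suc (a + i) + (k + (j + d))
  lem₃ = solve-∀
  mirrored : Period c k ℓ d
  mirrored j lt with i , refl ← m≤n⇒∃[o]m+o≡n lt =
    trans (sym (rev-+ c (a + (i + d)) (k + j) (lem₁ a j d i k)))
      (trans (sym (per i (≤-trans (m≤m+n (suc (i + d)) j) (≤-reflexive (lem₂ i d j)))))
        (rev-+ c (a + i) (k + (j + d)) (lem₃ a j d i k)))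

splice : ℕ → (ℕ → A) → (ℕ → A) → ℕ → A
splice zero    s t n       = t n
splice (suc m) s t zero    = s zero
splice (suc m) s t (suc n) = splice m (s ∘ suc) t n

splice-< : ∀ (s t : ℕ → A) {m n} → n < m → splice m s t n ≡ s n
splice-< s t {suc m} {zero}  n<m       = refl
splice-< s t {suc m} {suc n} (s≤s n<m) = splice-< (s ∘ suc) t n<m

splice-+ : ∀ (s t : ℕ → A) m n → splice m s t (m + n) ≡ t n
splice-+ s t zero    n = refl
splice-+ s t (suc m) n = splice-+ (s ∘ suc) t m n

splice-cong : ∀ (s t : ℕ → A) m {c : ℕ → A} {n} → (∀ i → i < m → s i ≡ c i) →
              (∀ i → i < n → t i ≡ c (m + i)) → ∀ i → i < m + n → splice m s t i ≡ c i
splice-cong s t m {c} {n} eqs eqt i lt with i <? m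
... | yes i<m = trans (splice-< s t i<m) (eqs i i<m)
... | no  i≮m with i′ , refl ← m≤n⇒∃[o]m+o≡n (≮⇒≥ i≮m) =
  trans (splice-+ s t m i′) (eqt i′ (+-cancelˡ-< m i′ n lt))

avoids-splice-tail : ∀ {B : ℕ → ℕ → Set} (s t : ℕ → A) m {n a ℓ d} → Avoids B t n →
                     m ≤ a → a + ℓ ≤ m + n → B ℓ d → ¬ Period (splice m s t) a ℓ d
avoids-splice-tail s t m {n} {ℓ = ℓ} av m≤a le b
  with k , refl ← m≤n⇒∃[o]m+o≡n m≤a =
  av k _ _ (+-cancelˡ-≤ m (k + ℓ) n (subst (_≤ m + n) (+-assoc m k ℓ) le)) b
    ∘ period-transfer (splice m s t) (m + k) t k λ i _ →
        trans (cong (splice m s t) (+-assoc m k i)) (splice-+ s t m (k + i))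

-- Grafting an x-free word

-- From a position beyond threshold U n, n steps from p to some q with p ≤ 2 q + U + 2 stay
-- beyond U.
threshold : ℕ → ℕ → ℕ
threshold U zero    = U
threshold U (suc n) = threshold U n + threshold U n + suc (suc U)

threshold-mono : ∀ U {m n} → m ≤ n → threshold U m ≤ threshold U n
threshold-mono U {m} {zero}  z≤n = ≤-refl
threshold-mono U {m} {suc n} m≤1+n with m ≤? n
... | yes m≤n = ≤-trans (threshold-mono U m≤n)
                  (≤-trans (m≤m+n (threshold U n) (threshold U n))
                    (m≤m+n (threshold U n + threshold U n) (suc (suc U))))
... | no  m≰n with refl ← ≤-antisym m≤1+n (≰⇒> m≰n) = ≤-refl

double-cancel-≤ : ∀ {m n} → m + m ≤ n + n → m ≤ n
double-cancel-≤ {m} {n} le = ≮⇒≥ λ n<m → <⇒≱ (+-mono-< n<m n<m) le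

module _ {A : Set} (_≟ᴬ_ : DecidableEquality A) where

  -- Pigeonhole: if all U + 1 shifts occurred at the U positions, two shifts i < j would share one.
  -- Then `T` agrees with itself at distance j - i ≤ U for U + 1 letters, enough for an overlap of
  -- length 2(j - i) + 1 starting at i, which ends by 2U + 1 ≤ n.
  fresh-shift : ∀ (s T : ℕ → A) U {n} → U + U < n → Avoids Overlap T n →
                ∃[ i ] i ≤ U × (∀ q → q < U → ¬ (∀ {j} → j < suc U → s (suc q + j) ≡ T (i + j)))
  fresh-shift s T U {n} lt av = decide (any? fresh?)
    where
    Occurs : ℕ → ℕ → Set
    Occurs i q = ∀ {j} → j < suc U → s (suc q + j) ≡ T (i + j)

    occurs? : ∀ i q → Dec (Occurs i q)
    occurs? i q = allUpTo? (λ j → s (suc q + j) ≟ᴬ T (i + j)) (suc U)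

    Fresh : Fin (suc U) → Set
    Fresh i = ¬ (∃[ q ] q < U × Occurs (toℕ i) q)

    fresh? : ∀ i → Dec (Fresh i)
    fresh? i with anyUpTo? (occurs? (toℕ i)) U
    ... | yes p = no λ f → f p
    ... | no ¬p = yes ¬p

    decide : Dec (∃ Fresh) → ∃[ i ] i ≤ U × (∀ q → q < U → ¬ Occurs i q)
    decide (yes (i , f)) = toℕ i , ≤-pred (toℕ<n i) , λ q q<U o → f (q , q<U , λ {j} → o {j})
    decide (no none) = contradiction (pigeonhole ≤-refl position)
      λ (i , j , i<j , same) → clash i j i<j same
      where
      occurrence : ∀ i → ∃[ q ] q < U × Occurs (toℕ i) q
      occurrence i = decidable-stable (anyUpTo? (occurs? (toℕ i)) U) λ ¬p → none (i , ¬p)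

      position : Fin (suc U) → Fin U
      position i = fromℕ< (proj₁ (proj₂ (occurrence i)))

      toℕ-position : ∀ i → toℕ (position i) ≡ proj₁ (occurrence i)
      toℕ-position i = toℕ-fromℕ< (proj₁ (proj₂ (occurrence i)))

      occurs-at : ∀ i → Occurs (toℕ i) (toℕ (position i))
      occurs-at i = subst (Occurs (toℕ i)) (sym (toℕ-position i)) (proj₂ (proj₂ (occurrence i)))

      clash : ∀ i j → toℕ i < toℕ j → position i ≢ position j
      clash i j i<j same with d , eq ← m≤n⇒∃[o]m+o≡n i<j =
        av (toℕ i) (suc (suc d + suc d)) (suc d) inside (z<s , ≤-refl) per
        where
        i+d≡j : toℕ i + suc d ≡ toℕ j
        i+d≡j = trans (+-suc (toℕ i) d) eq
        j≤U : toℕ j ≤ U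
        j≤U = ≤-pred (toℕ<n j)
        d≤U : suc d ≤ U
        d≤U = ≤-trans (m≤n+m (suc d) (toℕ i)) (≤-trans (≤-reflexive i+d≡j) j≤U)
        lem₁ : ∀ i d → i + suc (d + d) ≡ suc (i + d + d)
        lem₁ = solve-∀
        lem₂ : ∀ i d k → i + d + k ≡ i + (k + d)
        lem₂ = solve-∀
        inside : toℕ i + suc (suc d + suc d) ≤ n
        inside = ≤-trans (≤-reflexive (lem₁ (toℕ i) (suc d)))
          (≤-trans (s≤s (+-mono-≤ (≤-trans (≤-reflexive i+d≡j) j≤U) d≤U)) lt)
        per : Period T (toℕ i) (suc (suc d + suc d)) (suc d)
        per k lt = trans (sym (occurs-at i k<1+U))
          (trans (cong (λ p → s (suc (toℕ p) + k)) same)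
            (trans (occurs-at j k<1+U)
              (cong T (trans (cong (_+ k) (sym i+d≡j)) (lem₂ (toℕ i) (suc d) k)))))
          where
          k<1+U : k < suc U
          k<1+U = s≤s (≤-trans (+-cancelʳ-≤ (suc d) k (suc d) (≤-pred lt)) d≤U)

  module _ {B : ℕ → ℕ → Set} (B⊆Square : ∀ {ℓ d} → B ℓ d → Square ℓ d)
           (s t : ℕ → A) (x : A) (U P M : ℕ)
           (s-avoids : Avoids B s (suc P)) (t-avoids : Avoids B t M)
           (t-free : ∀ i → i < M → t i ≢ x)
           (t-fresh : ∀ q → q < U → ¬ (∀ {j} → j < suc U → s (suc q + j) ≡ t j)) where

    private
      -- A match of length `l` can be lengthened at most U + 1 - l times before it exceeds U
      -- letters, where freshness of `t` takes over. The position must survive that many halvings.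
      lowest : ℕ → ℕ
      lowest l = threshold U (suc U ∸ l)

      Match : ℕ → ℕ → Set
      Match p l = s p ≡ x × p + l ≤ P × l ≤ M × (∀ {j} → j < l → s (suc p + j) ≡ t j)

      match? : ∀ p l → Dec (Match p l)
      match? p l = (s p ≟ᴬ x) ×-dec (p + l ≤? P) ×-dec (l ≤? M) ×-dec
                   allUpTo? (λ j → s (suc p + j) ≟ᴬ t j) l

      -- Progress is measured by the length of the match; `lowest l′ ≤ q` keeps its position far
      -- enough from the protected prefix.
      Better : ℕ → ℕ → ℕ → Set
      Better l q l′ = l < l′ × lowest l′ ≤ q × Match q l′

      better? : ∀ l q l′ → Dec (Better l q l′)
      better? l q l′ = (l <? l′) ×-dec (lowest l′ ≤? q) ×-dec match? q l′

      -- A match longer than U cannot start below U by `t-fresh`, and there `lowest l′` is U. For l′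
      -- ≤ U one unfolding of `threshold` gives 2 · `lowest l′` + U + 2 ≤ p ≤ 2q + U + 2.
      lowest-back : ∀ {p q l l′} → lowest l ≤ p → Match q l′ → l < l′ →
                    p ≤ q + q + suc l′ → lowest l′ ≤ q
      lowest-back {p} {q} {l} {l′} low (_ , _ , _ , agree) l<l′ close with suc U ≤? l′
      ... | yes U<l′ = subst (λ n → threshold U n ≤ q) (sym (m≤n⇒m∸n≡0 U<l′))
        (≮⇒≥ λ q<U → t-fresh q q<U λ j<1+U → agree (≤-trans j<1+U U<l′))
      ... | no  U≮l′ = double-cancel-≤ (+-cancelʳ-≤ (suc (suc U)) _ _ (begin
        lowest l′ + lowest l′ + suc (suc U) ≤⟨ threshold-mono U (∸-monoʳ-< l<l′ (<⇒≤ (≰⇒> U≮l′))) ⟩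
        lowest l                            ≤⟨ low ⟩
        p                                   ≤⟨ close ⟩
        q + q + suc l′                      ≤⟨ +-monoʳ-≤ (q + q) (≰⇒> U≮l′) ⟩
        q + q + suc U                       ≤⟨ +-monoʳ-≤ (q + q) (n≤1+n (suc U)) ⟩
        q + q + suc (suc U)                 ∎))
        where open ≤-Reasoning

      -- A period d ≤ l′ would carry the last x into t.
      short-period : ∀ a g {l′ d} → s (a + g) ≡ x → l′ ≤ M → suc d ≤ l′ →
                     ¬ Period (splice (suc (a + g)) s t) a (suc g + l′) (suc d)
      short-period a g {l′} {d} sp≡x l′≤M d<l′ per = t-free d (≤-trans d<l′ l′≤M)
        (trans (sym (splice-+ s t (suc (a + g)) d))
          (trans (cong c (lem a g d))
            (trans (sym (per g (s≤s (+-monoʳ-≤ g d<l′))))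
              (trans (splice-< s t ≤-refl) sp≡x))))
        where
        c : ℕ → A
        c = splice (suc (a + g)) s t
        lem : ∀ a g d → suc (a + g) + d ≡ a + (g + suc d)
        lem = solve-∀

      -- A period d > l′ makes x followed by l′ letters of t reappear d places earlier.
      long-period : ∀ a h {l′ d} → s (a + (h + d)) ≡ x → a + (h + d) ≤ P → l′ ≤ M → l′ < d →
                    Period (splice (suc (a + (h + d))) s t) a (suc (h + d) + l′) d →
                    Match (a + h) l′
      long-period a h {l′} {d} sp≡x p≤P l′≤M l′<d per =
        trans (sym (splice-< s t (s≤s (+-monoʳ-≤ a (m≤m+n h d)))))
          (trans (per h (s≤s (m≤m+n (h + d) l′))) (trans (splice-< s t ≤-refl) sp≡x)) ,
        ≤-trans (+-monoʳ-≤ (a + h) (<⇒≤ l′<d)) (≤-trans (≤-reflexive (+-assoc a h d)) p≤P) ,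
        l′≤M ,
        λ {j} j<l′ →
          trans (sym (splice-< s t (s≤s (earlier (<-trans j<l′ l′<d)))))
            (trans (cong c (lem₁ a h j))
              (trans (per (suc h + j) (s≤s (image< j<l′)))
                (trans (cong c (lem₂ a h j d)) (splice-+ s t (suc (a + (h + d))) j))))
        where
        c : ℕ → A
        c = splice (suc (a + (h + d))) s t
        lem₁ : ∀ a h j → suc (a + h) + j ≡ a + (suc h + j)
        lem₁ = solve-∀
        lem₂ : ∀ a h j d → a + (suc h + j + d) ≡ suc (a + (h + d)) + j
        lem₂ = solve-∀
        lem₃ : ∀ h j d → suc h + j + d ≡ h + d + suc j
        lem₃ = solve-∀
        earlier : ∀ {j} → j < d → suc (a + h) + j ≤ a + (h + d)
        earlier {j} j<d = ≤-trans (≤-reflexive (sym (+-suc (a + h) j)))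
          (≤-trans (+-monoʳ-≤ (a + h) j<d) (≤-reflexive (+-assoc a h d)))
        image< : ∀ {j} → j < l′ → suc h + j + d ≤ h + d + l′
        image< {j} j<l′ = ≤-trans (≤-reflexive (lem₃ h j d)) (+-monoʳ-≤ (h + d) j<l′)

      splice-avoids : ∀ {p l} → Match p l → lowest l ≤ p →
                      (∀ q l′ → q ≤ P → l′ ≤ P → ¬ Better l q l′) →
                      Avoids B (splice (suc p) s t) (suc p + M)
      splice-avoids {p} {l} (sp≡x , p+l≤P , l≤M , agree) low none a ℓ d le b per
        with a + ℓ ≤? suc p + l
      -- The factor ends within the `l` matched letters, where `t` reads the same as `s`, so it is
      -- already a factor of `s`.
      ... | yes short = s-avoids a ℓ d (≤-trans short (s≤s p+l≤P)) b
        (period-transfer (splice (suc p) s t) a s a (λ i lt →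
           splice-cong s t (suc p) (λ _ _ → refl) (λ j lt → sym (agree lt)) (a + i)
             (≤-trans (+-monoʳ-< a lt) short)) per)
      ... | no long with suc p ≤? a
      ... | yes p<a = avoids-splice-tail s t (suc p) t-avoids p<a le b per
      ... | no p≮a
        with g , refl ← m≤n⇒∃[o]m+o≡n (≤-pred (≰⇒> p≮a))
        with l′ , eq ← m≤n⇒∃[o]m+o≡n (<⇒≤ (≤-<-trans (m≤m+n (suc (a + g)) l) (≰⇒> long)))
        with refl ← +-cancelˡ-≡ a (suc g + l′) ℓ
                      (trans (trans (+-suc a (g + l′)) (cong suc (sym (+-assoc a g l′)))) eq)
        with s≤s {n = e} z≤n , 2d≤ℓ ← B⊆Square b
        with l<l′ ← +-cancelˡ-< (suc (a + g)) l l′ (subst (suc (a + g) + l <_) (sym eq) (≰⇒> long))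
        with l′≤M ← +-cancelˡ-≤ (suc (a + g)) l′ M (subst (_≤ suc (a + g) + M) (sym eq) le)
        with suc e ≤? l′
      ... | yes d≤l′ = short-period a g sp≡x l′≤M d≤l′ per
      ... | no  d≰l′
        -- With d = `suc e`, 2d ≤ ℓ = g + 1 + l′ and l′ < d force d ≤ g, so the place one period
        -- before p still lies in the factor; h = g - d is its offset.
        with h , eq′ ← m≤n⇒∃[o]m+o≡n (+-cancelʳ-≤ (suc e) (suc e) g (≤-trans 2d≤ℓ
               (≤-trans (≤-reflexive (sym (+-suc g l′))) (+-monoʳ-≤ g (≰⇒> d≰l′)))))
        with refl ← trans (+-comm h (suc e)) eq′ =
        none (a + h) l′ (≤-trans (m≤m+n (a + h) l′) q+l′≤P) (≤-trans (m≤n+m l′ (a + h)) q+l′≤P)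
          (l<l′ , lowest-back low match l<l′ close , match)
        where
        match : Match (a + h) l′
        match = long-period a h sp≡x (≤-trans (m≤m+n _ l) p+l≤P) l′≤M (≰⇒> d≰l′) per
        q+l′≤P : a + h + l′ ≤ P
        q+l′≤P = proj₁ (proj₂ match)
        lem₁ : ∀ h d l → suc (h + d) + l ≡ suc h + l + d
        lem₁ = solve-∀
        lem₂ : ∀ a h l → a + (h + (suc h + l)) + a ≡ a + h + (a + h) + suc l
        lem₂ = solve-∀
        d≤1+h+l′ : suc e ≤ suc h + l′
        d≤1+h+l′ = +-cancelʳ-≤ (suc e) _ _ (≤-trans 2d≤ℓ (≤-reflexive (lem₁ h (suc e) l′)))
        -- Here 2d ≤ ℓ = h + d + 1 + l′ gives d ≤ h + 1 + l′. Hence for q = a + h, p = q + d ≤ 2q +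
        -- l′ + 1: the position at most about halves.
        close : a + (h + suc e) ≤ a + h + (a + h) + suc l′
        close = ≤-trans (+-monoʳ-≤ a (+-monoʳ-≤ h d≤1+h+l′))
          (≤-trans (m≤m+n _ a) (≤-reflexive (lem₂ a h l′)))

    -- Replace the match by a better one as long as one exists. Lengths increase strictly and are
    -- bounded by `P`, so the fuel `f` suffices; the search is decidable because `q` and `l′` are
    -- bounded by `P` as well. At the end U ≤ p, since `lowest` never drops below U.
    extend-chain : ∀ f {p l} → P < l + f → Match p l → lowest l ≤ p →
                   ∃[ p ] U ≤ p × p ≤ P × s p ≡ x × Avoids B (splice (suc p) s t) (suc p + M)
    extend-chain f {p} {l} fuel m low
      with anyUpTo? (λ q → anyUpTo? (better? l q) (suc P)) (suc P)
    ... | no none = p , ≤-trans (threshold-mono U {n = suc U ∸ l} z≤n) low , ≤-trans (m≤m+n p l) (proj₁ (proj₂ m)) ,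
      proj₁ m , splice-avoids m low λ q l′ q≤P l′≤P b → none (q , s≤s q≤P , l′ , s≤s l′≤P , b)
    extend-chain zero {p} {l} fuel m low | yes _ =
      contradiction (≤-trans (m≤n+m l p) (proj₁ (proj₂ m)))
        (<⇒≱ (subst (P <_) (+-identityʳ l) fuel))
    extend-chain (suc f) {p} {l} fuel m low | yes (q , _ , l′ , _ , l<l′ , low′ , m′) =
      extend-chain f (≤-trans fuel (≤-trans (≤-reflexive (+-suc l f)) (+-monoˡ-≤ f l<l′))) m′ low′

module _ {A : Set} (_≟ᴬ_ : DecidableEquality A)
         {B : ℕ → ℕ → Set} (B⊆Square : ∀ {ℓ d} → B ℓ d → Square ℓ d) where

  Grafted : (ℕ → A) → (ℕ → A) → ℕ → ℕ → ℕ → Set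
  Grafted s T U P M =
    ∃[ p ] ∃[ i ] U ≤ p × p ≤ P × i ≤ U × s p ≡ s P ×
      Avoids B (splice (suc p) s (λ m → T (i + m))) (suc p + M)

  graft : ∀ (s T : ℕ → A) U P M → threshold U (suc U) ≤ P → U < M →
          Avoids B s (suc P) → Avoids B T (U + M) → Avoids Overlap T (U + M) →
          (∀ i → i < U + M → T i ≢ s P) → Grafted s T U P M
  graft s T U P M low U<M s-avoids T-avoids T-overlap T-free =
    along (fresh-shift _≟ᴬ_ s T U (+-monoʳ-< U U<M) T-overlap)
    where
    along : (∃[ i ] i ≤ U × (∀ q → q < U → ¬ (∀ {j} → j < suc U → s (suc q + j) ≡ T (i + j)))) →
            Grafted s T U P M
    along (i , i≤U , fresh)
      with p , U≤p , p≤P , sp≡x , av ←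
             extend-chain _≟ᴬ_ B⊆Square s (λ m → T (i + m)) (s P) U P M s-avoids
               (avoids-drop T i (avoids-shorten T {m = i + M} (+-monoˡ-≤ M i≤U) T-avoids))
               (λ m m<M → T-free (i + m) (+-mono-≤-< i≤U m<M)) fresh
               -- The chain starts from the empty match at `P`, for which `lowest 0` is exactly the
               -- bound assumed on `P`.
               (suc P) {P} {0} ≤-refl (refl , ≤-reflexive (+-identityʳ P) , z≤n , λ ()) low
      = p , i , U≤p , p≤P , i≤U , sp≡x , av

  -- The shift i is not known beforehand, so the target letter is addressed in `T` itself: its
  -- position U + n lies beyond every possible shift, at offset (U - i) + n of the graft.
  graft-to : ∀ (s T : ℕ → A) {U P M} n → U + n < M → Grafted s T U P M →
             ∃[ s′ ] ∃[ P′ ] n ≤ P′ × Avoids B s′ (suc P′) ×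
               (∀ i → i < U → s′ i ≡ s i) × s′ P′ ≡ T (U + n)
  graft-to s T n U+n<M (p , i , U≤p , _ , i≤U , _ , av)
    with o , refl ← m≤n⇒∃[o]m+o≡n i≤U =
    c , suc p + (o + n) ,
    ≤-trans (m≤n+m n o) (m≤n+m (o + n) (suc p)) ,
    avoids-shorten c (≤-trans (≤-reflexive (sym (+-suc (suc p) (o + n)))) (+-monoʳ-≤ (suc p) o+n<M)) av ,
    (λ j j<U → splice-< s (λ m → T (i + m)) (≤-trans j<U (m≤n⇒m≤1+n U≤p))) ,
    trans (splice-+ s (λ m → T (i + m)) (suc p) (o + n)) (cong T (sym (+-assoc i o n)))
    where
    c : ℕ → A
    c = splice (suc p) s (λ m → T (i + m))
    o+n<M : o + n < _
    o+n<M = ≤-<-trans (≤-trans (m≤n+m (o + n) i) (≤-reflexive (sym (+-assoc i o n)))) U+n<M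

  -- Joining two grafted words over a common middle

  module _ (s s′ T : ℕ → A) (V p p′ i j mid : ℕ) where

    private
      K : ℕ
      K = i + j + mid

      -- The left graft `c` reads `T` forwards from V + i; the right one `c′` reads it backwards
      -- from V + K - 1 - j. They share the `mid` letters of `T` from V + i on, and `W` overlays `c`
      -- with the mirror image of `c′` along these.
      c c′ W : ℕ → A
      c  = splice (suc p) s (λ m → T (V + (i + m)))
      c′ = splice (suc p′) s′ (λ m → rev (V + K) T (j + m))
      W  = splice (suc p) s (rev (mid + suc p′) c′)

      mid≤K : mid ≤ K
      mid≤K = m≤n+m mid (i + j)

    bridge-middle : ∀ n → n < mid → W (suc p + n) ≡ T (V + (i + n))
    bridge-middle n n<mid with e , eq ← m≤n⇒∃[o]m+o≡n n<mid =
      trans (splice-+ s (rev (mid + suc p′) c′) (suc p) n)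
        (trans (rev-+ c′ n (suc p′ + e) (trans (cong (_+ suc p′) (sym eq)) (lem₁ n e p′)))
          (trans (splice-+ s′ (λ m → rev (V + K) T (j + m)) (suc p′) e)
            (rev-+ T (j + e) (V + (i + n))
              (trans (cong (λ m → V + (i + j + m)) (sym eq)) (lem₂ V i j n e)))))
      where
      lem₁ : ∀ n e p → suc n + e + suc p ≡ suc n + (suc p + e)
      lem₁ = solve-∀
      lem₂ : ∀ V i j n e → V + (i + j + (suc n + e)) ≡ suc (j + e) + (V + (i + n))
      lem₂ = solve-∀

    bridge-suffix : ∀ n e → n + e ≡ p′ → W (suc p + (mid + n)) ≡ s′ e
    bridge-suffix n e eq =
      trans (splice-+ s (rev (mid + suc p′) c′) (suc p) (mid + n))
        (trans (rev-+ c′ (mid + n) e (trans (cong (λ v → mid + suc v) (sym eq)) (lem mid n e)))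
          (splice-< s′ (λ m → rev (V + K) T (j + m)) (s≤s (≤-trans (m≤n+m e n) (≤-reflexive eq)))))
      where
      lem : ∀ m n e → m + suc (n + e) ≡ suc (m + n) + e
      lem = solve-∀

    module _ (T-free : ∀ i → T i ≢ s p) (long-middle : p + p′ < mid) where

      private
        -- The factor reaches past the middle, so a period of at most `mid` would carry the letter
        -- `s p` at position p into the middle, where all letters come from `T`.
        short-period-absurd : ∀ {a g ℓ d} → a + g ≡ p → suc p + mid < a + ℓ → suc d ≤ mid →
                              ¬ Period W a ℓ (suc d)
        short-period-absurd {a} {g} {ℓ} {d} eq long d<mid per = T-free (V + (i + d))
          (trans (sym (bridge-middle d d<mid))
            (trans (cong W position)
              (trans (sym (per g (+-cancelˡ-< a _ _ (≤-<-trans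
                       (≤-trans (≤-reflexive (sym position)) (+-monoʳ-≤ (suc p) (<⇒≤ d<mid))) long))))
                (trans (cong W eq) (splice-< s (rev (mid + suc p′) c′) ≤-refl)))))
          where
          lem : ∀ a g d → suc (a + g) + d ≡ a + (g + suc d)
          lem = solve-∀
          position : suc p + d ≡ a + (g + suc d)
          position = trans (cong (λ q → suc q + d) (sym eq)) (lem a g d)

        -- Two periods take at least 2 · mid + 2 letters, but `W` has p + p′ + mid + 2 and p + p′ <
        -- mid.
        long-period-absurd : ∀ {a ℓ d} → a + ℓ ≤ suc p + (mid + suc p′) → d + d ≤ ℓ → mid < d → ⊥
        long-period-absurd {a} {ℓ} {d} le 2d≤ℓ mid<d =
          <⇒≱ long-middle (+-cancelʳ-≤ (suc mid + 1) mid (p + p′) (begin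
            mid + (suc mid + 1)       ≡⟨ lem₂ mid ⟨
            suc mid + suc mid         ≤⟨ +-mono-≤ mid<d mid<d ⟩
            d + d                     ≤⟨ 2d≤ℓ ⟩
            ℓ                         ≤⟨ m≤n+m ℓ a ⟩
            a + ℓ                     ≤⟨ le ⟩
            suc p + (mid + suc p′)    ≡⟨ lem₁ p p′ mid ⟩
            p + p′ + (suc mid + 1)    ∎))
          where
          open ≤-Reasoning
          lem₁ : ∀ p p′ mid → suc p + (mid + suc p′) ≡ p + p′ + (suc mid + 1)
          lem₁ = solve-∀
          lem₂ : ∀ mid → suc mid + suc mid ≡ mid + (suc mid + 1)
          lem₂ = solve-∀

      -- A repetition reaching over both copies of x has a period longer than the middle part,
      -- and the whole word is too short for two such periods.
      bridge-avoids : Avoids B c (suc p + K) → Avoids B c′ (suc p′ + K) →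
                      Avoids B W (suc p + (mid + suc p′))
      bridge-avoids left right a ℓ d le b per with a + ℓ ≤? suc p + mid
      ... | yes short = left a ℓ d (≤-trans short (+-monoʳ-≤ (suc p) mid≤K)) b
        (period-transfer W a c a (λ n n<ℓ →
          splice-cong s (rev (mid + suc p′) c′) (suc p) {c = c}
            (λ k k<p → sym (splice-< s (λ m → T (V + (i + m))) k<p))
            (λ k k<mid →
              trans (sym (splice-+ s (rev (mid + suc p′) c′) (suc p) k))
                (trans (bridge-middle k k<mid) (sym (splice-+ s (λ m → T (V + (i + m))) (suc p) k))))
            (a + n) (≤-trans (+-monoʳ-< a n<ℓ) short)) per)
      ... | no long with suc p ≤? a
      ... | yes p<a = avoids-splice-tail s (rev (mid + suc p′) c′) (suc p)
        (avoids-rev c′ (avoids-shorten c′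
          (≤-trans (≤-reflexive (+-comm mid (suc p′))) (+-monoʳ-≤ (suc p′) mid≤K)) right)) p<a le b per
      ... | no p≮a
        with g , eq ← m≤n⇒∃[o]m+o≡n (≤-pred (≰⇒> p≮a))
        with s≤s {n = e} z≤n , 2d≤ℓ ← B⊆Square b
        with suc e ≤? mid
      ... | yes d≤mid = short-period-absurd eq (≰⇒> long) d≤mid per
      ... | no  d≰mid = long-period-absurd {a = a} le 2d≤ℓ (≰⇒> d≰mid)

  bridge : ∀ (s s′ T : ℕ → A) {U V K p p′ i j} → U ≤ p → V ≤ p′ → i + j ≤ K → p + p′ + (i + j) < K →
           (∀ m → T m ≢ s p) →
           Avoids B (splice (suc p) s (λ m → T (V + (i + m)))) (suc p + K) →
           Avoids B (splice (suc p′) s′ (λ m → rev (V + K) T (j + m))) (suc p′ + K) →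
           ∃[ W ] ∃[ m ] Avoids B W (U + (m + V)) ×
             (∀ n → n < U → W n ≡ s n) × (∀ n → n < V → W (U + (m + n)) ≡ rev V s′ n)
  bridge s s′ T {U} {V} {i = i} {j} U≤p V≤p′ i+j≤K long T-free left right
    with mid , refl ← m≤n⇒∃[o]m+o≡n i+j≤K
    with x , refl ← m≤n⇒∃[o]m+o≡n U≤p
    with y , refl ← m≤n⇒∃[o]m+o≡n V≤p′ =
    -- With x = p - U and y = p′ - V, the connecting word is the rest of `s` through p, then the
    -- middle, then the mirrored rest of `s′` from p′ down to V.
    W , suc x + (mid + suc y) ,
    avoids-shorten W (≤-reflexive (lem₁ U V x y mid))
      (bridge-avoids s s′ T V (U + x) (V + y) i j mid T-free
        (+-cancelʳ-< (i + j) _ mid (≤-trans long (≤-reflexive (+-comm (i + j) mid)))) left right) ,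
    (λ n n<U → splice-< s _ (≤-trans n<U (m≤n⇒m≤1+n U≤p))) ,
    suffix
    where
    W : ℕ → A
    W = splice (suc (U + x)) s
          (rev (mid + suc (V + y)) (splice (suc (V + y)) s′ (λ m → rev (V + (i + j + mid)) T (j + m))))
    lem₁ : ∀ U V x y mid → U + (suc x + (mid + suc y) + V) ≡ suc (U + x) + (mid + suc (V + y))
    lem₁ = solve-∀
    lem₂ : ∀ U x mid y n → U + (suc x + (mid + suc y) + n) ≡ suc (U + x) + (mid + (suc y + n))
    lem₂ = solve-∀
    lem₃ : ∀ y n e → suc y + n + e ≡ suc n + e + y
    lem₃ = solve-∀
    suffix : ∀ n → n < V → W (U + (suc x + (mid + suc y) + n)) ≡ rev V s′ n
    suffix n n<V with e , eq ← m≤n⇒∃[o]m+o≡n n<V =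
      trans (cong W (lem₂ U x mid y n))
        (trans (bridge-suffix s s′ T V (U + x) (V + y) i j mid (suc y + n) e
                 (trans (lem₃ y n e) (cong (_+ y) eq)))
          (sym (rev-+ s′ n e (sym eq))))

  -- `K` exceeds p + p′ + i + j for every outcome of the two grafts, so after both shifts the common
  -- middle is still longer than p + p′. The V letters of `T` before this window leave room for the
  -- shift of the backward graft, the U letters after it for that of the forward graft.
  join : ∀ (s s′ T : ℕ → A) U V P P′ → let K = suc (P + P′ + (U + V)) in
         threshold U (suc U) ≤ P → threshold V (suc V) ≤ P′ → s P ≡ s′ P′ →
         Avoids B s (suc P) → Avoids B s′ (suc P′) →
         Avoids B T (V + (U + K)) → Avoids Overlap T (V + (U + K)) → (∀ i → T i ≢ s P) →
         ∃[ W ] ∃[ m ] Avoids B W (U + (m + V)) ×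
           (∀ n → n < U → W n ≡ s n) × (∀ n → n < V → W (U + (m + n)) ≡ rev V s′ n)
  join s s′ T U V P P′ low low′ same s-avoids s′-avoids T-avoids T-overlap T-free =
    glue (graft s (λ m → T (V + m)) U P K low (≤-<-trans (m≤m+n U V) U+V<K) s-avoids
           (avoids-drop T V T-avoids) (avoids-drop T V T-overlap) (λ m _ → T-free (V + m)))
         (graft s′ (rev (V + K) T) V P′ K low′ (≤-<-trans (m≤n+m V U) U+V<K) s′-avoids
           (avoids-rev T (avoids-shorten T (+-monoʳ-≤ V (m≤n+m K U)) T-avoids))
           (avoids-rev T (avoids-shorten T (+-monoʳ-≤ V (m≤n+m K U)) T-overlap))
           (λ m _ eq → T-free (V + K ∸ suc m) (trans eq (sym same))))
    where
    K : ℕ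
    K = suc (P + P′ + (U + V))
    U+V<K : U + V < K
    U+V<K = s≤s (m≤n+m (U + V) (P + P′))
    glue : Grafted s (λ m → T (V + m)) U P K → Grafted s′ (rev (V + K) T) V P′ K → _
    glue (p , i , U≤p , p≤P , i≤U , sp≡x , left) (p′ , j , V≤p′ , p′≤P′ , j≤V , _ , right) =
      bridge s s′ T U≤p V≤p′ (≤-trans (+-mono-≤ i≤U j≤V) (<⇒≤ U+V<K))
        (s≤s (+-mono-≤ (+-mono-≤ p≤P p′≤P′) (+-mono-≤ i≤U j≤V)))
        (λ m eq → T-free m (trans eq sp≡x)) left right

-- Overlap-free and square-free words

odd : ℕ → Bool
odd zero    = false
odd (suc n) = not (odd n)

xor-cancelˡ : ∀ a {b c} → a xor b ≡ a xor c → b ≡ c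
xor-cancelˡ false eq = eq
xor-cancelˡ true  eq = not-injective eq

odd-double-+ : ∀ m n → odd (n + (m + m)) ≡ odd n
odd-double-+ zero    n = cong odd (+-identityʳ n)
odd-double-+ (suc m) n = trans (cong odd (lem m n)) (trans (not-involutive _) (odd-double-+ m n))
  where
  lem : ∀ m n → n + (suc m + suc m) ≡ suc (suc (n + (m + m)))
  lem = solve-∀

half-double-+ : ∀ m n → ⌊ n + (m + m) /2⌋ ≡ ⌊ n /2⌋ + m
half-double-+ zero    n = trans (cong ⌊_/2⌋ (+-identityʳ n)) (sym (+-identityʳ _))
half-double-+ (suc m) n = trans (cong ⌊_/2⌋ (lem m n))
  (trans (cong suc (half-double-+ m n)) (sym (+-suc ⌊ n /2⌋ m)))
  where
  lem : ∀ m n → n + (suc m + suc m) ≡ suc (suc (n + (m + m)))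
  lem = solve-∀

even⊎odd : ∀ n → ∃[ m ] (n ≡ m + m ⊎ n ≡ suc (m + m))
even⊎odd zero = 0 , inj₁ refl
even⊎odd (suc n) with even⊎odd n
... | m , inj₁ refl = m , inj₂ refl
... | m , inj₂ refl = suc m , inj₁ (cong suc (sym (+-suc m m)))

-- The Thue–Morse word, but correct on the first 2 ^ f letters only.
thueMorse : ℕ → ℕ → Bool
thueMorse zero    n = false
thueMorse (suc f) n = odd n xor thueMorse f ⌊ n /2⌋

half-suc-even : ∀ n → odd n ≡ false → ⌊ suc n /2⌋ ≡ ⌊ n /2⌋
half-suc-even zero          _  = refl
half-suc-even (suc (suc n)) eq = cong suc (half-suc-even n (trans (sym (not-involutive _)) eq))

-- Positions n and n + 1 with n even have the same half, so only the parity bit changes.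
thueMorse-pair : ∀ f n → odd n ≡ false → thueMorse (suc f) (suc n) ≡ not (thueMorse (suc f) n)
thueMorse-pair f n even rewrite even = cong not (cong (thueMorse f) (half-suc-even n even))

alternating : ∀ (c : ℕ → Bool) d → (∀ j → j < d → c (suc j) ≡ not (c j)) → c d ≡ odd d xor c 0
alternating c zero    alt = refl
alternating c (suc d) alt = trans (alt d ≤-refl)
  (trans (cong not (alternating c d λ j lt → alt j (m≤n⇒m≤1+n lt))) (not-xor (odd d) (c 0)))
  where
  not-xor : ∀ a b → not (a xor b) ≡ not a xor b
  not-xor false b = refl
  not-xor true  b = not-involutive b

-- For d = 2e, reading every second letter leaves an overlap of period e one level down. For odd d,
-- the letters from a to a + d alternate, so the two end letters differ, against the period.
thueMorse-overlap-free : ∀ f → Avoids Overlap (thueMorse f) (2 ^ f)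
thueMorse-overlap-free zero a ℓ (suc d) le (_ , lt) _ =
  contradiction (≤-trans (≤-trans (s≤s (s≤s z≤n)) lt) (≤-trans (m≤n+m ℓ a) le)) λ { (s≤s ()) }
thueMorse-overlap-free (suc f) a ℓ d le (0<d , 2d<ℓ) per with even⊎odd d
... | e , inj₁ refl = thueMorse-overlap-free f ⌊ a /2⌋ (suc (e + e)) e inside (0<e e 0<d , ≤-refl) halved
  where
  0<e : ∀ e → 0 < e + e → 0 < e
  0<e (suc e) _ = z<s
  lem : ∀ j e → j + j + (e + e) ≡ (j + e) + (j + e)
  lem = solve-∀
  lem′ : ∀ f → f + (f + 0) ≡ f + f
  lem′ = solve-∀
  inside : ⌊ a /2⌋ + suc (e + e) ≤ 2 ^ f
  inside = begin
    ⌊ a /2⌋ + suc (e + e)             ≡⟨ +-suc ⌊ a /2⌋ (e + e) ⟩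
    suc (⌊ a /2⌋ + (e + e))           ≡⟨ half-double-+ (e + e) (suc (suc a)) ⟨
    ⌊ suc (suc (a + (e + e + (e + e)))) /2⌋ ≤⟨ ⌊n/2⌋-mono (s≤s (≤-trans (≤-trans
                                                 (≤-reflexive (sym (+-suc a _))) (+-monoʳ-≤ a 2d<ℓ))
                                                 (≤-trans le (≤-reflexive (lem′ (2 ^ f)))))) ⟩
    ⌊ 1 + (2 ^ f + 2 ^ f) /2⌋         ≡⟨ half-double-+ (2 ^ f) 1 ⟩
    2 ^ f                             ∎
    where open ≤-Reasoning
  halved : Period (thueMorse f) ⌊ a /2⌋ (suc (e + e)) e
  halved j lt = begin
    thueMorse f (⌊ a /2⌋ + j)             ≡⟨ cong (thueMorse f) (half-double-+ j a) ⟨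
    thueMorse f ⌊ a + (j + j) /2⌋         ≡⟨ xor-cancelˡ (odd a) same ⟩
    thueMorse f ⌊ a + (k + k) /2⌋         ≡⟨ cong (thueMorse f) (half-double-+ k a) ⟩
    thueMorse f (⌊ a /2⌋ + k)             ∎
    where
    open ≡-Reasoning
    k : ℕ
    k = j + e
    j≤e : j ≤ e
    j≤e = +-cancelʳ-≤ e j e (≤-pred lt)
    same : odd a xor thueMorse f ⌊ a + (j + j) /2⌋ ≡ odd a xor thueMorse f ⌊ a + (k + k) /2⌋
    same = begin
      odd a xor thueMorse f ⌊ a + (j + j) /2⌋
        ≡⟨ cong (_xor thueMorse f ⌊ a + (j + j) /2⌋) (odd-double-+ j a) ⟨
      thueMorse (suc f) (a + (j + j))
        ≡⟨ per (j + j) (≤-<-trans (+-monoˡ-≤ (e + e) (+-mono-≤ j≤e j≤e)) 2d<ℓ) ⟩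
      thueMorse (suc f) (a + (j + j + (e + e)))
        ≡⟨ cong (λ n → thueMorse (suc f) (a + n)) (lem j e) ⟩
      thueMorse (suc f) (a + (k + k))
        ≡⟨ cong (_xor thueMorse f ⌊ a + (k + k) /2⌋) (odd-double-+ k a) ⟩
      odd a xor thueMorse f ⌊ a + (k + k) /2⌋ ∎
... | e , inj₂ refl = not-¬ {c d} {c 0} (sym (per 0 (≤-<-trans (m≤m+n d d) 2d<ℓ)))
  (trans (alternating c d steps) (cong (_xor c 0) odd-d))
  where
  c : ℕ → Bool
  c j = thueMorse (suc f) (a + j)
  odd-d : odd (suc (e + e)) ≡ true
  odd-d = odd-double-+ e 1
  lem : ∀ a j e → a + (j + suc (e + e)) ≡ suc (a + j) + (e + e)
  lem = solve-∀
  -- Aligned pairs alternate, and d is odd, so one of the pairs at a + j and a + j + d is aligned.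
  steps : ∀ j → j < suc (e + e) → c (suc j) ≡ not (c j)
  steps j j<d = by-parity (odd (a + j)) refl
    where
    open ≡-Reasoning
    by-parity : ∀ b → odd (a + j) ≡ b → c (suc j) ≡ not (c j)
    by-parity false parity = trans (cong (thueMorse (suc f)) (+-suc a j)) (thueMorse-pair f (a + j) parity)
    by-parity true parity = begin
      c (suc j)
        ≡⟨ per (suc j) (≤-<-trans (+-monoˡ-≤ d j<d) 2d<ℓ) ⟩
      c (suc (j + d))
        ≡⟨ cong (thueMorse (suc f)) (+-suc a (j + d)) ⟩
      thueMorse (suc f) (suc (a + (j + d)))
        ≡⟨ thueMorse-pair f (a + (j + d))
             (trans (cong odd (lem a j e)) (trans (odd-double-+ e (suc (a + j))) (cong not parity))) ⟩
      not (c (j + d))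
        ≡⟨ cong not (per j (≤-<-trans (+-monoˡ-≤ d (<⇒≤ j<d)) 2d<ℓ)) ⟨
      not (c j) ∎

-- Sign of b − a, with 1 standing for +1 and 2 for −1.
difference : Bool → Bool → Fin 3
difference false true  = suc zero
difference true  false = suc (suc zero)
difference _     _     = zero

difference-cancelˡ : ∀ {x y z w} → difference x y ≡ difference z w → x ≡ z → y ≡ w
difference-cancelˡ {false} {false} {w = false} _ refl = refl
difference-cancelˡ {false} {true}  {w = true}  _ refl = refl
difference-cancelˡ {true}  {false} {w = false} _ refl = refl
difference-cancelˡ {true}  {true}  {w = true}  _ refl = refl

difference-≢ : ∀ {x y z w} → difference x y ≡ difference z w → x ≢ z → y ≡ x × y ≢ w
difference-≢ {false} {_}     {false} {_}     _ x≢z = contradiction refl x≢z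
difference-≢ {true}  {_}     {true}  {_}     _ x≢z = contradiction refl x≢z
difference-≢ {false} {false} {true}  {true}  _ x≢z = refl , x≢z
difference-≢ {true}  {true}  {false} {false} _ x≢z = refl , x≢z
difference-≢ {false} {true}  {true}  {false} () _
difference-≢ {true}  {false} {false} {true}  () _

-- In a square of differences, if the blocks of `c` start with equal letters, they agree throughout,
-- including the one extra letter that d differences involve, and `c` has an overlap of length 2d +
-- 1.
differences-square-free : ∀ (c : ℕ → Bool) {n} → Avoids Overlap c (suc n) →
                          Avoids Square (λ i → difference (c i) (c (suc i))) n
differences-square-free c {n} av a ℓ d le (0<d , 2d≤ℓ) per = split (c (a + 0) ≟ᵇ c (a + d))
  where
  aligned : ∀ j → j < d → difference (c (a + j)) (c (a + suc j)) ≡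
                          difference (c (a + (j + d))) (c (a + suc (j + d)))
  aligned j j<d = trans (cong (λ i → difference (c (a + j)) (c i)) (+-suc a j))
    (trans (per j (<-≤-trans (+-monoˡ-< d j<d) 2d≤ℓ))
      (cong (λ i → difference (c (a + (j + d))) (c i)) (sym (+-suc a (j + d)))))

  agree : c (a + 0) ≡ c (a + d) → ∀ j → j ≤ d → c (a + j) ≡ c (a + (j + d))
  agree eq zero    _   = eq
  agree eq (suc j) j<d = difference-cancelˡ (aligned j j<d) (agree eq j (<⇒≤ j<d))

  -- Equal differences of unequal letters vanish, so c would be constant on the first block.
  differ : c (a + 0) ≢ c (a + d) → ∀ j → j ≤ d →
           c (a + j) ≡ c (a + 0) × c (a + j) ≢ c (a + (j + d))
  differ ne zero    _   = refl , ne
  differ ne (suc j) j<d with same , ne′ ← differ ne j (<⇒≤ j<d)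
    with same′ , ne″ ← difference-≢ (aligned j j<d) ne′ = trans same′ same , ne″

  split : Dec (c (a + 0) ≡ c (a + d)) → ⊥
  split (yes eq) = av a (suc (d + d)) d
    (≤-trans (≤-reflexive (+-suc a (d + d))) (s≤s (≤-trans (+-monoʳ-≤ a 2d≤ℓ) le)))
    (0<d , ≤-refl) λ j lt → agree eq j (+-cancelʳ-≤ d j d (≤-pred lt))
  split (no ne) = ne (sym (proj₁ (differ ne d ≤-refl)))

-- Lists and rational exponents

-- Positions beyond the end of the list read the junk letter e.
at : A → List A → ℕ → A
at e []       _       = e
at e (x ∷ xs) zero    = x
at e (x ∷ xs) (suc n) = at e xs n

module _ (e : A) where

  at-++ˡ : ∀ xs ys {i} → i < length xs → at e (xs ++ ys) i ≡ at e xs i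
  at-++ˡ (x ∷ xs) ys {zero}  lt       = refl
  at-++ˡ (x ∷ xs) ys {suc i} (s≤s lt) = at-++ˡ xs ys lt

  at-++ʳ : ∀ xs ys i → at e (xs ++ ys) (length xs + i) ≡ at e ys i
  at-++ʳ []       ys i = refl
  at-++ʳ (x ∷ xs) ys i = at-++ʳ xs ys i

  at-++-cong : ∀ {c : ℕ → A} xs ys {n} → (∀ i → i < length xs → c i ≡ at e xs i) →
               (∀ i → i < n → c (length xs + i) ≡ at e ys i) →
               ∀ i → i < length xs + n → c i ≡ at e (xs ++ ys) i
  at-++-cong []       ys eqx eqy i       lt       = eqy i lt
  at-++-cong (x ∷ xs) ys eqx eqy zero    lt       = eqx 0 z<s
  at-++-cong (x ∷ xs) ys eqx eqy (suc i) (s≤s lt) =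
    at-++-cong xs ys (λ i lt → eqx (suc i) (s≤s lt)) eqy i lt

  at-applyUpTo : ∀ (c : ℕ → A) n i → i < n → at e (applyUpTo c n) i ≡ c i
  at-applyUpTo c (suc n) zero    lt       = refl
  at-applyUpTo c (suc n) (suc i) (s≤s lt) = at-applyUpTo (c ∘ suc) n i lt

  prefix⇒at : ∀ {xs ys i} → Prefix _≡_ xs ys → i < length xs → at e xs i ≡ at e ys i
  prefix⇒at {i = zero}  (eq ∷ p) lt       = eq
  prefix⇒at {i = suc i} (eq ∷ p) (s≤s lt) = prefix⇒at p lt

  at⇒prefix : ∀ xs ys → length xs ≤ length ys →
              (∀ i → i < length xs → at e xs i ≡ at e ys i) → Prefix _≡_ xs ys
  at⇒prefix []       ys       le       eq = []
  at⇒prefix (x ∷ xs) (y ∷ ys) (s≤s le) eq =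
    eq 0 z<s ∷ at⇒prefix xs ys le λ i lt → eq (suc i) (s≤s lt)

prefix-++⁺ : ∀ (r : List A) {xs ys} → Prefix _≡_ xs ys → Prefix _≡_ (r ++ xs) (r ++ ys)
prefix-++⁺ []      p = p
prefix-++⁺ (x ∷ r) p = refl ∷ prefix-++⁺ r p

prefix-++⁻ : ∀ (r : List A) {y w} → Prefix _≡_ y (r ++ w) →
             Prefix _≡_ y r ⊎ (∃[ y′ ] y ≡ r ++ y′ × Prefix _≡_ y′ w)
prefix-++⁻ []      p          = inj₂ (_ , refl , p)
prefix-++⁻ (x ∷ r) []         = inj₁ []
prefix-++⁻ (x ∷ r) (refl ∷ p) with prefix-++⁻ r p
... | inj₁ q              = inj₁ (refl ∷ q)
... | inj₂ (y , refl , q) = inj₂ (y , refl , q)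

power-prefix : ∀ m (r t : List A) → Prefix _≡_ t r →
               Prefix _≡_ (concat (replicate m r) ++ t) (r ++ concat (replicate m r) ++ t)
power-prefix zero    r t p = p ++ᵖ t
power-prefix (suc m) r t p =
  subst (λ x → Prefix _≡_ x (r ++ x)) (sym (++-assoc r (concat (replicate m r)) t))
    (prefix-++⁺ r (power-prefix m r t p))

-- Either `y` lies within `r`, or y = r y′ and y′ is again a prefix of r y′. As `r` is nonempty each
-- removal shortens the word, and `n` bounds their number.
prefix-power : ∀ n (r y : List A) → r ≢ [] → length y ≤ n → Prefix _≡_ y (r ++ y) →
               ∃[ m ] ∃[ t ] Prefix _≡_ t r × y ≡ concat (replicate m r) ++ t
prefix-power n r y r≢[] le p with prefix-++⁻ r p
... | inj₁ q = 0 , y , q , refl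
prefix-power n       []      y r≢[] le p | inj₂ _ = contradiction refl r≢[]
prefix-power (suc n) (x ∷ r) _ r≢[] (s≤s le) p | inj₂ (y′ , refl , q)
  with m , t , pre , eq ← prefix-power n (x ∷ r) y′ r≢[]
         (≤-trans (≤-trans (m≤n+m (length y′) (length r)) (≤-reflexive (sym (length-++ r)))) le) q =
  suc m , t , pre ,
  trans (cong ((x ∷ r) ++_) eq) (sym (++-assoc (x ∷ r) (concat (replicate m (x ∷ r))) t))

split-at : ∀ n (xs : List A) → n ≤ length xs → ∃[ ys ] ∃[ zs ] xs ≡ ys ++ zs × length ys ≡ n
split-at zero    xs       le       = [] , xs , refl , refl
split-at (suc n) (x ∷ xs) (s≤s le) with ys , zs , refl , refl ← split-at n xs le =
  x ∷ ys , zs , refl , refl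

power-period : ∀ (e : A) m (r t : List A) → Prefix _≡_ t r → let x = concat (replicate m r) ++ t in
               Period (at e x) 0 (length x) (length r)
power-period e m r t p j lt = sym
  (trans (prefix⇒at e (power-prefix m r t p) lt)
    (trans (cong (at e (r ++ x)) (+-comm j (length r))) (at-++ʳ e r x j)))
  where x = concat (replicate m r) ++ t

period-power : ∀ (e : A) r y → r ≢ [] → Period (at e (r ++ y)) 0 (length (r ++ y)) (length r) →
               ∃[ m ] ∃[ t ] Prefix _≡_ t r × r ++ y ≡ concat (replicate m r) ++ t
period-power e r y r≢[] per
  with m , t , pre , eq ← prefix-power (length y) r y r≢[] ≤-refl
         (at⇒prefix e y (r ++ y) (≤-trans (m≤n+m (length y) (length r)) (≤-reflexive (sym (length-++ r))))
           λ i lt → trans (sym (at-++ʳ e r y i))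
             (trans (cong (at e (r ++ y)) (+-comm (length r) i))
               (sym (per i (<-≤-trans (+-monoˡ-< (length r) lt)
                 (≤-reflexive (trans (+-comm (length y) (length r)) (sym (length-++ r)))))))))
  = suc m , t , pre , trans (cong (r ++_) eq) (sym (++-assoc r (concat (replicate m r)) t))

-- The equation forces `β` to be ℓ / d, with no division needed.
Bad : Exponent → ℕ → ℕ → Set
Bad α ℓ d = 0 < d × ∃[ β ] 1ℚ ℚ.≤ β × fromℕ ℓ ≡ β ℚ.* fromℕ d × Forbidden α β

avoids⇒powerFree : ∀ {k} (e : Fin k) (α : Exponent) (w : Word k) →
                   Avoids (Bad α) (at e w) (length w) → PowerFree α w
avoids⇒powerFree e α w av (x , r , β , infix-x , (r≢[] , 1≤β , m , t , pre , refl , len) , forb)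
  with Infix.toView infix-x
... | MkView p pw q with refl ← Pointwise-≡⇒≡ pw =
  av (length p) (length x) (length r) inside (positive r r≢[] , β , 1≤β , len , forb)
    (period-transfer (at e x) 0 (at e w) (length p)
      (λ i lt → sym (trans (at-++ʳ e p (x ++ q) i) (at-++ˡ e x q lt)))
      (power-period e m r t pre))
  where
  positive : ∀ r → r ≢ [] → 0 < length r
  positive []      r≢[] = contradiction refl r≢[]
  positive (_ ∷ _) _    = z<s
  inside : length p + length x ≤ length (p ++ x ++ q)
  inside = ≤-trans (+-monoʳ-≤ (length p) (≤-trans (m≤m+n _ (length q)) (≤-reflexive (sym (length-++ x)))))
    (≤-reflexive (sym (length-++ p)))

powerFree⇒avoids : ∀ {k} (e : Fin k) (α : Exponent) (w : Word k) →
                   (∀ {ℓ d} → Bad α ℓ d → Square ℓ d) →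
                   PowerFree α w → Avoids (Bad α) (at e w) (length w)
powerFree⇒avoids e α w bad⊆square pf a ℓ d le b@(0<d , β , 1≤β , len , forb) per
  with p , w′ , refl , refl ← split-at a w (≤-trans (m≤m+n a ℓ) le)
  with x , q , refl , refl ← split-at ℓ w′ (+-cancelˡ-≤ (length p) _ _ (≤-trans le (≤-reflexive (length-++ p))))
  -- `Square` supplies d ≤ ℓ, so a complete root `r` can be cut off.
  with r , y , refl , refl ← split-at d x (≤-trans (m≤m+n d d) (proj₂ (bad⊆square b))) =
  pf (r ++ y , r , β , Infix.fromView (MkView p (≡⇒Pointwise-≡ refl) q) ,
      (r≢[] , 1≤β , proj₁ power , proj₁ (proj₂ power) , proj₁ (proj₂ (proj₂ power)) ,
       proj₂ (proj₂ (proj₂ power)) , len) , forb)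
  where
  r≢[] : r ≢ []
  r≢[] refl = n≮0 0<d
  power = period-power e r y r≢[] (period-transfer (at e w) (length p) (at e (r ++ y)) 0
    (λ i lt → trans (at-++ʳ e p w′ i) (at-++ˡ e (r ++ y) q lt)) per)

toℚᵘ-fromℕ : ∀ n → ℚ.toℚᵘ (fromℕ n) ℚᵘ.≃ mkℚᵘ (ℤ.+ n) 0
toℚᵘ-fromℕ n = ℚ.toℚᵘ-fromℚᵘ (mkℚᵘ (ℤ.+ n) 0)

fromℕ-*2 : ∀ n → fromℕ 2 ℚ.* fromℕ n ≡ fromℕ (n + n)
fromℕ-*2 n = ℚ.toℚᵘ-injective (begin
  ℚ.toℚᵘ (fromℕ 2 ℚ.* fromℕ n)             ≈⟨ ℚ.toℚᵘ-homo-* (fromℕ 2) (fromℕ n) ⟩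
  ℚ.toℚᵘ (fromℕ 2) ℚᵘ.* ℚ.toℚᵘ (fromℕ n)   ≈⟨ ℚᵘ.*-congˡ {ℚ.toℚᵘ (fromℕ 2)} (toℚᵘ-fromℕ n) ⟩
  mkℚᵘ (ℤ.+ 2) 0 ℚᵘ.* mkℚᵘ (ℤ.+ n) 0       ≡⟨ cong (λ i → mkℚᵘ i 0) 2*n≡n+n ⟩
  mkℚᵘ (ℤ.+ (n + n)) 0                     ≈⟨ toℚᵘ-fromℕ (n + n) ⟨
  ℚ.toℚᵘ (fromℕ (n + n))                   ∎)
  where
  open ℚᵘ.≃-Reasoning
  2*n≡n+n : ℤ.+ 2 ℤ.* ℤ.+ n ≡ ℤ.+ (n + n)
  2*n≡n+n = trans (sym (ℤ.pos-* 2 n)) (cong (λ m → ℤ.+ (n + m)) (+-identityʳ n))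

fromℕ-cancel-≤ : ∀ {m n} → fromℕ m ℚ.≤ fromℕ n → m ≤ n
fromℕ-cancel-≤ {m} {n} le = ℤ.drop‿+≤+ (subst₂ ℤ._≤_ (ℤ.*-identityʳ (ℤ.+ m)) (ℤ.*-identityʳ (ℤ.+ n))
  (ℚᵘ.drop-*≤* (ℚᵘ.≤-respˡ-≃ (toℚᵘ-fromℕ m) (ℚᵘ.≤-respʳ-≃ (toℚᵘ-fromℕ n) (ℚ.toℚᵘ-mono-≤ le)))))

fromℕ-cancel-< : ∀ {m n} → fromℕ m ℚ.< fromℕ n → m < n
fromℕ-cancel-< {m} {n} lt = ℤ.drop‿+<+ (subst₂ ℤ._<_ (ℤ.*-identityʳ (ℤ.+ m)) (ℤ.*-identityʳ (ℤ.+ n))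
  (ℚᵘ.drop-*<* (ℚᵘ.<-respˡ-≃ (toℚᵘ-fromℕ m) (ℚᵘ.<-respʳ-≃ (toℚᵘ-fromℕ n) (ℚ.toℚᵘ-mono-< lt)))))

bad⇒square : ∀ α → (∀ {β} → Forbidden α β → fromℕ 2 ℚ.≤ β) → ∀ {ℓ d} → Bad α ℓ d → Square ℓ d
bad⇒square α 2≤ {ℓ} {d} (0<d , β , _ , len , forb) = 0<d , fromℕ-cancel-≤
  (subst₂ ℚ._≤_ (fromℕ-*2 d) (sym len) (ℚ.*-monoʳ-≤-nonNeg (fromℕ d) {{ℚ.normalize-nonNeg d 1}} (2≤ forb)))

bad⇒overlap : ∀ α → (∀ {β} → Forbidden α β → fromℕ 2 ℚ.< β) → ∀ {ℓ d} → Bad α ℓ d → Overlap ℓ d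
bad⇒overlap α 2< {ℓ} {d} (0<d , β , _ , len , forb) = 0<d , fromℕ-cancel-<
  (subst₂ ℚ._<_ (fromℕ-*2 d) (sym len)
    (ℚ.*-monoˡ-<-pos (fromℕ d) {{ℚ.normalize-pos d 1 {{_}} {{>-nonZero 0<d}}}} (2< forb)))

-- Transitions

transpose-at : ∀ {n} (i j : Fin n) → transpose i j i ≡ j
transpose-at i j with i ≟ᶠ i
... | yes _  = refl
... | no i≢i = contradiction refl i≢i

transpose-injective : ∀ {n} (i j : Fin n) {k l} → transpose i j k ≡ transpose i j l → k ≡ l
transpose-injective i j eq =
  trans (sym (transpose-inverse j i)) (trans (cong (transpose j i) eq) (transpose-inverse j i))

-- `punchIn x` misses `x`, and a transposition beforehand sends the letter at `n` to the preimage of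
-- `y`. Injective recoding creates no new periods.
recode : ∀ {B B′ : ℕ → ℕ → Set} {j k N} (c : ℕ → Fin j) → j ≤ k → Avoids B c N → Avoids B′ c N →
         ∀ {x y : Fin (suc k)} → x ≢ y → ∀ n →
         ∃[ T ] T n ≡ y × (∀ m → T m ≢ x) × Avoids B T N × Avoids B′ T N
recode {B} {B′} {k = k} {N} c j≤k av av′ {x} {y} x≢y n =
  f ∘ c ,
  trans (cong (punchIn x) (transpose-at (inject≤ (c n) j≤k) (punchOut x≢y))) (punchIn-punchOut x≢y) ,
  (λ m → punchInᵢ≢i x _) ,
  avoids-map {B = B} c f f-injective av , avoids-map {B = B′} c f f-injective av′
  where
  f : Fin _ → Fin (suc k)
  f a = punchIn x (transpose (inject≤ (c n) j≤k) (punchOut x≢y) (inject≤ a j≤k))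
  f-injective : ∀ {a b} → f a ≡ f b → a ≡ b
  f-injective {a} {b} eq = inject≤-injective j≤k j≤k a b
    (transpose-injective (inject≤ (c n) j≤k) (punchOut x≢y) (punchIn-injective x _ _ eq))

n<2^n : ∀ n → n < 2 ^ n
n<2^n zero    = ≤-refl
n<2^n (suc n) = ≤-trans (s≤s (n<2^n n)) (≤-trans (+-monoˡ-≤ (2 ^ n) (m^n>0 2 n))
  (+-monoʳ-≤ (2 ^ n) (m≤m+n (2 ^ n) 0)))

overlap⇒square : ∀ {ℓ d} → Overlap ℓ d → Square ℓ d
overlap⇒square (0<d , 2d<ℓ) = 0<d , <⇒≤ 2d<ℓ

bit : Bool → Fin 2
bit false = zero
bit true  = suc zero

bit-injective : ∀ {a b} → bit a ≡ bit b → a ≡ b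
bit-injective {false} {false} _ = refl
bit-injective {true}  {true}  _ = refl

binary : ∀ N → Avoids Overlap (bit ∘ thueMorse N) N
binary N = avoids-map (thueMorse N) bit bit-injective
  (avoids-shorten (thueMorse N) (<⇒≤ (n<2^n N)) (thueMorse-overlap-free N))

ternary-word : ℕ → ℕ → Fin 3
ternary-word N i = difference (thueMorse N i) (thueMorse N (suc i))

ternary-square-free : ∀ N → Avoids Square (ternary-word N) N
ternary-square-free N = differences-square-free (thueMorse N)
  (avoids-shorten (thueMorse N) (n<2^n N) (thueMorse-overlap-free N))

υ-size : ∀ {k α} → Υ k α → 2 < k
υ-size (ternary _)    = ≤-refl
υ-size (larger 3<k _) = <⇒≤ 3<k
υ-size (plus 3≤k _)   = 3≤k

υ-square : ∀ {k α} → Υ k α → ∀ {ℓ d} → Bad α ℓ d → Square ℓ d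
υ-square {α = α} (ternary 2<α)  = bad⇒square α λ α≤β → ℚ.≤-trans (ℚ.<⇒≤ 2<α) α≤β
υ-square {α = α} (larger _ 2≤α) = bad⇒square α λ α≤β → ℚ.≤-trans 2≤α α≤β
υ-square {α = α} (plus _ 2≤α)   = bad⇒square α λ α<β → ℚ.≤-trans 2≤α (ℚ.<⇒≤ α<β)

-- Banning `x` costs one letter. Where every forbidden exponent exceeds 2, two remaining letters
-- suffice for the Thue-Morse word; where squares may be forbidden, k > 3 leaves three letters for a
-- square-free word.
supply : ∀ {k α} → Υ (suc k) α → ∀ N {x y : Fin (suc k)} → x ≢ y → ∀ n →
         ∃[ T ] T n ≡ y × (∀ m → T m ≢ x) × Avoids (Bad α) T N × Avoids Overlap T N
supply {α = α} (ternary 2<α) N =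
  recode (bit ∘ thueMorse N) ≤-refl
    (avoids-⊆ (bit ∘ thueMorse N) (bad⇒overlap α λ α≤β → ℚ.<-≤-trans 2<α α≤β) (binary N))
    (binary N)
supply {α = α} (plus (s≤s 2≤k) 2≤α) N =
  recode (bit ∘ thueMorse N) 2≤k
    (avoids-⊆ (bit ∘ thueMorse N) (bad⇒overlap α λ α<β → ℚ.≤-<-trans 2≤α α<β) (binary N))
    (binary N)
supply υ@(larger (s≤s 3≤k) _) N =
  recode (ternary-word N) 3≤k
    (avoids-⊆ (ternary-word N) (υ-square υ) (ternary-square-free N))
    (avoids-⊆ (ternary-word N) overlap⇒square (ternary-square-free N))

module _ {k α} (υ : Υ (suc (suc k)) α) where

  Transition : (s s′ : ℕ → Fin (suc (suc k))) → ℕ → ℕ → Set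
  Transition s s′ U V =
    ∃[ W ] ∃[ m ] Avoids (Bad α) W (U + (m + V)) ×
      (∀ n → n < U → W n ≡ s n) × (∀ n → n < V → W (U + (m + n)) ≡ rev V s′ n)

  join-same-letter : ∀ s s′ U V P P′ → threshold U (suc U) ≤ P → threshold V (suc V) ≤ P′ →
                     s P ≡ s′ P′ → Avoids (Bad α) s (suc P) → Avoids (Bad α) s′ (suc P′) →
                     Transition s s′ U V
  join-same-letter s s′ U V P P′ low low′ same s-avoids s′-avoids =
    let T , _ , T-free , T-avoids , T-overlap =
          -- `punchIn (s P) zero` is simply some letter other than `s P`.
          supply υ (V + (U + suc (P + P′ + (U + V)))) (punchInᵢ≢i (s P) zero ∘ sym) 0
    in join _≟ᶠ_ (υ-square υ) s s′ T U V P P′ low low′ same s-avoids s′-avoids T-avoids T-overlap T-free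

  change-letter : ∀ s U P {y} → threshold U (suc U) ≤ P → s P ≢ y → Avoids (Bad α) s (suc P) →
                  ∃[ s₁ ] ∃[ P₁ ] threshold U (suc U) ≤ P₁ × Avoids (Bad α) s₁ (suc P₁) ×
                    (∀ n → n < U → s₁ n ≡ s n) × s₁ P₁ ≡ y
  change-letter s U P low ne s-avoids =
    let T , Tn≡y , T-free , T-avoids , T-overlap = supply υ (U + M) ne n
        s₁ , P₁ , low₁ , s₁-avoids , s₁≈s , s₁P₁≡ =
          graft-to _≟ᶠ_ (υ-square υ) s T (threshold U (suc U)) ≤-refl
            (graft _≟ᶠ_ (υ-square υ) s T U P M low (s≤s (m≤m+n U _)) s-avoids T-avoids T-overlap
              λ i _ → T-free i)
    in s₁ , P₁ , low₁ , s₁-avoids , s₁≈s , trans s₁P₁≡ Tn≡y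
    where
    n M : ℕ
    -- `y` is put at this index of `T` so that, whatever the shift, it lands at a position beyond
    -- the threshold, ready for another graft.
    n = U + threshold U (suc U)
    M = suc n

  transition : ∀ s s′ U V P P′ → threshold U (suc U) ≤ P → threshold V (suc V) ≤ P′ →
               Avoids (Bad α) s (suc P) → Avoids (Bad α) s′ (suc P′) → Transition s s′ U V
  transition s s′ U V P P′ low low′ s-avoids s′-avoids = via (s P ≟ᶠ s′ P′)
    where
    via : Dec (s P ≡ s′ P′) → Transition s s′ U V
    via (yes same) = join-same-letter s s′ U V P P′ low low′ same s-avoids s′-avoids
    via (no ne) =
      let s₁ , P₁ , low₁ , s₁-avoids , s₁≈s , same = change-letter s U P low ne s-avoids
          W , m , W-avoids , W≈s₁ , W≈s′ =
            join-same-letter s₁ s′ U V P₁ P′ low₁ low′ same s₁-avoids s′-avoids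
      in W , m , W-avoids , (λ n n<U → trans (W≈s₁ n n<U) (s₁≈s n n<U)) , W≈s′

transition-word : ∀ {k α} → Υ (suc (suc k)) α → (u v : Word (suc (suc k))) →
                  u ∈ rext (L _ α) → v ∈ lext (L _ α) →
                  ∃[ w ] w ∈ L _ α × u ++ w ++ v ∈ L _ α
transition-word {k} {α} υ u v (_ , extend) (_ , extend′) =
  assemble (left (extend (suc P))) (right (extend′ (suc P′)))
  where
  U V P P′ : ℕ
  U  = length u
  V  = length v
  P  = threshold U (suc U)
  P′ = threshold V (suc V)

  e : Fin (suc (suc k))
  e = zero

  left : (∃[ u′ ] u′ ∈ L _ α × length u′ ≡ suc P × u ++ u′ ∈ L _ α) →
         ∃[ s ] Avoids (Bad α) s (suc P) × (∀ n → n < U → s n ≡ at e u n)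
  left (u′ , _ , len , free) =
    at e (u ++ u′) ,
    avoids-shorten (at e (u ++ u′)) (≤-trans (m≤n+m (suc P) U) (≤-reflexive
        (sym (trans (length-++ u) (cong (U +_) len)))))
      (powerFree⇒avoids e α (u ++ u′) (υ-square υ) free) ,
    λ n → at-++ˡ e u u′

  right : (∃[ v′ ] v′ ∈ L _ α × length v′ ≡ suc P′ × v′ ++ v ∈ L _ α) →
          ∃[ s ] Avoids (Bad α) s (suc P′) × (∀ n → n < V → rev V s n ≡ at e v n)
  right (v′ , _ , len , free) =
    -- Mirroring turns the left extension of `v` into a word with the reversal of `v` as prefix, so
    -- both sides are grafted in the same way.
    rev N c ,
    avoids-shorten (rev N c)
      (≤-trans (≤-reflexive (sym len))
        (≤-trans (m≤m+n _ V) (≤-reflexive (sym (length-++ v′)))))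
      (avoids-rev c (powerFree⇒avoids e α (v′ ++ v) (υ-square υ) free)) ,
    λ n n<V → let d , eq = m≤n⇒∃[o]m+o≡n n<V in
      trans (rev-+ (rev N c) n d (sym eq))
        (trans (rev-+ c d (length v′ + n)
            (trans (length-++ v′) (trans (cong (length v′ +_) (sym eq)) (lem (length v′) n d))))
          (at-++ʳ e v′ v n))
    where
    N = length (v′ ++ v)
    c = at e (v′ ++ v)
    lem : ∀ l n d → l + (suc n + d) ≡ suc d + (l + n)
    lem = solve-∀

  assemble : (∃[ s ] Avoids (Bad α) s (suc P) × (∀ n → n < U → s n ≡ at e u n)) →
             (∃[ s ] Avoids (Bad α) s (suc P′) × (∀ n → n < V → rev V s n ≡ at e v n)) →
             ∃[ w ] w ∈ L _ α × u ++ w ++ v ∈ L _ α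
  assemble (s , s-avoids , s-extends) (s′ , s′-avoids , s′-extends)
    with W , m , av , W-left , W-right ←
           transition υ s s′ U V P P′ ≤-refl ≤-refl s-avoids s′-avoids =
    w , avoids⇒powerFree e α w (avoids-cong c (at e w) (λ i lt → sym (at-w i (subst (i <_) len lt)))
          (avoids-shorten c (≤-trans (≤-reflexive len) (m≤m+n m V)) (avoids-drop W U av))) ,
    avoids⇒powerFree e α (u ++ w ++ v) (subst (Avoids (Bad α) (at e (u ++ w ++ v))) (sym total)
      (avoids-cong W (at e (u ++ w ++ v))
        (at-++-cong e u (w ++ v) (λ i lt → trans (W-left i lt) (s-extends i lt)) inner) av))
    where
    c : ℕ → Fin (suc (suc k))
    c i = W (U + i)
    w : Word (suc (suc k))
    w = applyUpTo c m
    len : length w ≡ m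
    len = length-applyUpTo c m
    at-w : ∀ i → i < m → at e w i ≡ c i
    at-w = at-applyUpTo e c m
    total : length (u ++ w ++ v) ≡ U + (m + V)
    total = trans (length-++ u) (cong (U +_) (trans (length-++ w) (cong (_+ V) len)))
    inner : ∀ i → i < m + V → c i ≡ at e (w ++ v) i
    inner i lt = at-++-cong e w v
      (λ i lt → sym (at-w i (subst (i <_) len lt)))
      (λ i lt → trans (cong (λ n → c (n + i)) len) (trans (W-right i lt) (s′-extends i lt)))
      i (subst (λ n → i < n + V) (sym len) lt)

mainTheorem1 : ∀ (k : ℕ) (α : Exponent) → Υ k α →
    ∀ (u v : Word k) → u ∈ rext (L k α) → v ∈ lext (L k α) →
    ∃[ w ] w ∈ L k α × u ++ w ++ v ∈ L k α
mainTheorem1 (suc (suc k)) α υ = transition-word υ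
mainTheorem1 0 α υ = contradiction (υ-size υ) λ ()
mainTheorem1 1 α υ = contradiction (υ-size υ) λ { (s≤s ()) }
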